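{- Let $H$ and $G$ be graphs with $G\in\operatorname{obs}^\ast(H)$. Then, up to isomorphism, \[\operatorname{obs}(G)=(\operatorname{obs}(H)\setminus\{G\})\cup\operatorname{obs}^\ast(G).\]
   Context: All graphs are finite, simple and loopless. A full-homomorphism $\varphi\colon G\to H$ is a map $V(G)\to V(H)$ such that for all $x,y\in V(G)$, $xy\in E(G)$ if and only if $\varphi(x)\varphi(y)\in E(H)$. A full $H$-colouring of $G$ is a full-homomorphism $G\to H$. A minimal $H$-obstruction is a graph $G$ that admits no full $H$-colouring while every proper induced subgraph of $G$ admits one; $\operatorname{obs}(H)$ denotes the set of minimal $H$-obstructions (up to isomorphism), and $\operatorname{obs}^\ast(H)$ the set of minimal $H$-obstructions on exactly $|V(H)|+1$ vertices. -}

module Defs where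

open import Data.Fin using (Fin; zero; suc)
open import Data.Fin.Properties using (suc-injective)
open import Data.Fin.Subset using (Subset; inside; outside; ∣_∣; _∈_; _⊂_; ⊤)
open import Data.Nat using (ℕ; _+_)
open import Data.Product using (Σ-syntax; ∃-syntax; _×_; _,_)
open import Data.Vec using ([]; _∷_; here; there)
open import Function using (_∘_)
open import Function.Bundles using (_⇔_; _↔_; Inverse)
open import Function.Definitions using (Injective)
open import Level using (0ℓ)
open import Relation.Binary.Core using (Rel)
open import Relation.Binary.Definitions using (Decidable; Irreflexive; Symmetric)
open import Relation.Binary.PropositionalEquality using (_≡_; refl; cong)
open import Relation.Nullary using (¬_)
open import Relation.Unary using (Pred)

-- Every finite graph is, up to isomorphism, a graph on some Fin n.  The graph
-- without vertices is allowed.  Decidability of adjacency is what finiteness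
-- of a graph gives classically.
record Graph : Set₁ where
  field
    order   : ℕ
    Adj     : Rel (Fin order) 0ℓ
    adj?    : Decidable Adj
    sym     : Symmetric Adj
    irrefl  : Irreflexive _≡_ Adj

  Vertex : Set
  Vertex = Fin order

open Graph using (order; Vertex; Adj)

IsFullHom : (G H : Graph) → (Vertex G → Vertex H) → Set
IsFullHom G H φ = ∀ x y → Adj G x y ⇔ Adj H (φ x) (φ y)

FullColouring : Graph → Graph → Set
FullColouring H G = Σ[ φ ∈ (Vertex G → Vertex H) ] IsFullHom G H φ

infix 4 _≅_

_≅_ : Graph → Graph → Set
G ≅ H = Σ[ f ∈ (Vertex G ↔ Vertex H) ] IsFullHom G H (Inverse.to f)

-- The elements of S, listed in increasing order.
enumerate : ∀ {n} (S : Subset n) → Fin ∣ S ∣ → Fin n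
enumerate (inside  ∷ S) zero    = zero
enumerate (inside  ∷ S) (suc i) = suc (enumerate S i)
enumerate (outside ∷ S) i       = suc (enumerate S i)

enumerate-injective : ∀ {n} (S : Subset n) → Injective _≡_ _≡_ (enumerate S)
enumerate-injective (inside  ∷ S) {zero}  {zero}  _  = refl
enumerate-injective (inside  ∷ S) {suc _} {suc _} eq =
  cong suc (enumerate-injective S (suc-injective eq))
enumerate-injective (outside ∷ S) eq = enumerate-injective S (suc-injective eq)

enumerate-∈ : ∀ {n} (S : Subset n) i → enumerate S i ∈ S
enumerate-∈ (inside  ∷ S) zero    = here
enumerate-∈ (inside  ∷ S) (suc i) = there (enumerate-∈ S i)
enumerate-∈ (outside ∷ S) i       = there (enumerate-∈ S i)

enumerate-complete : ∀ {n} (S : Subset n) {x} → x ∈ S → ∃[ i ] enumerate S i ≡ x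
enumerate-complete (inside  ∷ S) here      = zero , refl
enumerate-complete (inside  ∷ S) (there p) with enumerate-complete S p
... | i , refl = suc i , refl
enumerate-complete (outside ∷ S) (there p) with enumerate-complete S p
... | i , refl = i , refl

-- The subgraph of G induced by S, with the vertices of S renumbered by
-- their position in S.
induced : (G : Graph) → Subset (order G) → Graph
induced G S = record
  { order  = ∣ S ∣
  ; Adj    = λ i j → Adj G (enumerate S i) (enumerate S j)
  ; adj?   = λ i j → Graph.adj? G (enumerate S i) (enumerate S j)
  ; sym    = Graph.sym G
  ; irrefl = Graph.irrefl G ∘ cong (enumerate S)
  }

-- obs and obs* contain all isomorphic copies of their members, rather than one
-- representative of each isomorphism class.
obs : Graph → Pred Graph 0ℓ
obs H G = ¬ FullColouring H G × (∀ S → S ⊂ ⊤ → FullColouring H (induced G S))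

obs* : Graph → Pred Graph 0ℓ
obs* H G = obs H G × order G ≡ order H + 1

{-# OPTIONS --safe #-}

-- A minimal obstruction F is twin-free, since a vertex with a twin can be
-- folded onto it.  By Bondy's theorem, applied to the rows of the adjacency
-- matrix, some vertex v can be deleted so that distinct vertices of F are still
-- told apart by their neighbours other than v, and then a full colouring of
-- F - v is injective.  Hence members of obs G have at most |G| + 1 vertices, and
-- for G in obs* H the colouring of some G - v is a bijection onto H, so that H
-- embeds in G.  On the other hand, each full homomorphism to G that misses a
-- vertex factors through a proper induced subgraph of G and so yields a full
-- H-colouring; this applies to proper induced subgraphs of an F in obs G with at
-- most |G| vertices, and to every F in obs H not isomorphic to G that maps to G.
module Submission where

open import Defs
open import Data.Bool using (Bool)
import Data.Bool.Properties as Bool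
open import Data.Fin using (Fin; zero; suc; punchIn; punchOut)
open import Data.Fin.Properties
  using (_≟_; suc-injective; all?; any?; ¬∀⟶∃¬; injective⇒≤;
         punchIn-injective; punchInᵢ≢i; punchIn-punchOut)
open import Data.Fin.Subset using (Subset; ∣_∣; ∁; ⁅_⁆; _⊂_; ⊤)
open import Data.Fin.Subset.Properties
  using (∈⊤; ⊆⊤; ∣⊤∣≡n; p⊂q⇒∣p∣<∣q∣; x∈⁅x⁆; x∈p⇒x∉∁p; x∉p⇒x∈∁p; x≢y⇒x∉⁅y⁆)
open import Data.Nat using (ℕ; zero; suc; z≤n; s≤s; _+_; _≤_; _<_)
import Data.Nat.Properties as ℕ
open import Data.Product using (Σ-syntax; ∃-syntax; _,_; proj₁; proj₂)
open import Data.Sum using (_⊎_; inj₁; inj₂)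
open import Data.Vec.Functional using (_∷_)
open import Function using (_∘_; id)
open import Function.Bundles using (_⇔_; mk⇔; mk↔ₛ′; Inverse)
open import Function.Definitions using (Injective; StrictlySurjective)
open import Function.Properties.Equivalence using (⇔-isEquivalence)
open import Level using (0ℓ)
open import Relation.Binary.PropositionalEquality
  using (_≡_; _≢_; refl; sym; trans; cong; subst; subst₂)
open import Relation.Binary.Structures using (IsEquivalence)
open import Relation.Nullary using (¬_; Dec; yes; no; does; contradiction)
open import Relation.Nullary.Decidable using (does-⇔; decidable-stable)
open import Relation.Unary using (_∈_; _≐_; _∪_; _∖_)

open Graph using (order; Vertex; Adj; adj?)
open IsEquivalence (⇔-isEquivalence {0ℓ}) using ()
  renaming (refl to ⇔-refl; sym to ⇔-sym; trans to ⇔-trans)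

private
  variable
    m n : ℕ

Misses : (Fin m → Fin n) → Fin n → Set
Misses f v = ∀ x → f x ≢ v

surjective⊎misses : (f : Fin m → Fin n) → StrictlySurjective _≡_ f ⊎ ∃[ v ] Misses f v
surjective⊎misses f with all? (λ v → any? (λ x → f x ≟ v))
... | yes surj = inj₁ surj
... | no ¬surj with ¬∀⟶∃¬ _ _ (λ v → any? (λ x → f x ≟ v)) ¬surj
...   | v , v∉f = inj₂ (v , λ x fx≡v → v∉f (x , fx≡v))

surjective⇒≥ : {f : Fin m → Fin n} → StrictlySurjective _≡_ f → n ≤ m
surjective⇒≥ {f = f} surj = injective⇒≤ λ {x} {y} eq →
  trans (sym (proj₂ (surj x))) (trans (cong f eq) (proj₂ (surj y)))

<⇒misses : m < n → (f : Fin m → Fin n) → ∃[ v ] Misses f v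
<⇒misses m<n f with surjective⊎misses f
... | inj₁ surj = contradiction (surjective⇒≥ surj) (ℕ.<⇒≱ m<n)
... | inj₂ miss = miss

injective∧misses⇒< : {f : Fin m → Fin n} → Injective _≡_ _≡_ f → ∀ {v} → Misses f v → m < n
injective∧misses⇒< {f = f} inj {v} miss = injective⇒≤ v∷f-injective
  where
  v∷f-injective : Injective _≡_ _≡_ (v ∷ f)
  v∷f-injective {zero}  {zero}  _  = refl
  v∷f-injective {zero}  {suc y} eq = contradiction (sym eq) (miss y)
  v∷f-injective {suc x} {zero}  eq = contradiction eq (miss x)
  v∷f-injective {suc x} {suc y} eq = cong suc (inj eq)

injective⇒surjective : {f : Fin n → Fin n} → Injective _≡_ _≡_ f → StrictlySurjective _≡_ f
injective⇒surjective {f = f} inj with surjective⊎misses f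
... | inj₁ surj       = surj
... | inj₂ (_ , miss) = contradiction (injective∧misses⇒< inj miss) (ℕ.<-irrefl refl)

-- The rows of `M` stay distinct after restriction to the columns listed by `c`. Since `c` may
-- repeat columns, an index set of size `m` stands for at most `m` of them.
Separates : {A B C : Set} → (A → B → Bool) → (C → B) → Set
Separates M c = ∀ {x y} → (∀ i → M x (c i) ≡ M y (c i)) → x ≡ y

-- Bondy's theorem: columns separating all rows but one leave the remaining row
-- equal to at most one of them, so one additional column is enough.
separating-columns : ∀ m (M : Fin (suc m) → Fin n → Bool) → Separates M id →
                     ∃[ c ] Separates {C = Fin m} M c
separating-columns zero  M sep = (λ ()) , λ { {zero} {zero} _ → refl }
separating-columns {n} (suc m) M sep
  with c , c-sep ← separating-columns m (M ∘ suc) (λ eq → suc-injective (sep eq))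
  = d ∷ c , λ {x} {y} → d∷c-sep {x} {y}
  where
  Agrees : Fin (suc m) → Set
  Agrees y = ∀ i → M zero (c i) ≡ M (suc y) (c i)

  rival : ∃[ y ] (∀ x → Agrees x → x ≡ y)
  rival with any? (λ y → all? λ i → M zero (c i) Bool.≟ M (suc y) (c i))
  ... | yes (y , y-agrees) = y , λ x x-agrees → c-sep λ i → trans (sym (x-agrees i)) (y-agrees i)
  -- Here `zero` is an arbitrary default: nothing agrees with the new row, so the condition holds
  -- vacuously.
  ... | no  none           = zero , λ x x-agrees → contradiction (x , x-agrees) none

  distinguishing : ∃[ z ] M zero z ≢ M (suc (proj₁ rival)) z
  distinguishing = ¬∀⟶∃¬ _ _ (λ z → M zero z Bool.≟ M _ z) (λ eq → contradiction (sep eq) λ ())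

  d : Fin n
  d = proj₁ distinguishing

  zero≁suc : ∀ x → ¬ (∀ i → M zero ((d ∷ c) i) ≡ M (suc x) ((d ∷ c) i))
  zero≁suc x eq with refl ← proj₂ rival x (eq ∘ suc) = proj₂ distinguishing (eq zero)

  d∷c-sep : Separates M (d ∷ c)
  d∷c-sep {zero}  {zero}  _  = refl
  d∷c-sep {zero}  {suc y} eq = contradiction eq (zero≁suc y)
  d∷c-sep {suc x} {zero}  eq = contradiction (sym ∘ eq) (zero≁suc x)
  d∷c-sep {suc x} {suc y} eq = cong suc (c-sep (eq ∘ suc))

record Deletion (M : Fin n → Fin n → Bool) (m : ℕ) : Set where
  field
    embed           : Fin m → Fin n
    embed-injective : Injective _≡_ _≡_ embed
    deleted         : Fin n
    embed-misses    : Misses embed deleted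
    embed-separates : Separates M embed

-- The `m` separating columns cannot exhaust `suc m` indices, so some `v` is not among them; the
-- indices other than `v` include all of them and hence still separate. Taking the size as an
-- equation lets `n` be the order of a graph.
separating-deletion : (M : Fin n → Fin n → Bool) → Separates M id → n ≡ suc m → Deletion M m
separating-deletion {m = m} M sep refl
  with c , c-sep ← separating-columns m M sep
  with v , v∉c ← <⇒misses (ℕ.n<1+n m) c
  = record
  { embed           = punchIn v
  ; embed-injective = punchIn-injective v _ _
  ; deleted         = v
  ; embed-misses    = punchInᵢ≢i v
  ; embed-separates = λ {x} {y} eq → c-sep λ i →
      subst (λ z → M x z ≡ M y z) (punchIn-punchOut (v∉c i ∘ sym)) (eq (punchOut (v∉c i ∘ sym)))
  }

pullback : (G : Graph) → (Fin m → Vertex G) → Graph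
pullback {m} G f = record
  { order  = m
  ; Adj    = λ i j → Adj G (f i) (f j)
  ; adj?   = λ i j → adj? G (f i) (f j)
  ; sym    = Graph.sym G
  ; irrefl = Graph.irrefl G ∘ cong f
  }

compose : ∀ {F G H} → FullColouring H G → FullColouring G F → FullColouring H F
compose (φ , φ-full) (ψ , ψ-full) =
  φ ∘ ψ , λ x y → ⇔-trans (ψ-full x y) (φ-full (ψ x) (ψ y))

-- Because `s` reflects adjacency as well as preserving it, any lift of `f` through `s` as a map of
-- vertices is automatically full.
factor : ∀ {F G K} (f : Vertex F → Vertex G) → IsFullHom F G f →
         (s : Vertex K → Vertex G) → IsFullHom K G s →
         (g : Vertex F → Vertex K) → (∀ x → s (g x) ≡ f x) → IsFullHom F K g
factor {G = G} f f-full s s-full g sg≡f x y =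
  ⇔-trans (f-full x y)
    (⇔-trans (subst₂ (λ a b → Adj G (f x) (f y) ⇔ Adj G a b)
                     (sym (sg≡f x)) (sym (sg≡f y)) ⇔-refl)
             (⇔-sym (s-full (g x) (g y))))

section-full : ∀ {F G} (f : Vertex F → Vertex G) → IsFullHom F G f →
               (surj : StrictlySurjective _≡_ f) → IsFullHom G F (proj₁ ∘ surj)
section-full {F} {G} f f-full surj =
  factor {G} {G} {F} id (λ _ _ → ⇔-refl) f f-full (proj₁ ∘ surj) (proj₂ ∘ surj)

ProperlyColourable : Graph → Graph → Set
ProperlyColourable H G = ∀ S → S ⊂ ⊤ → FullColouring H (induced G S)

misses⇒colourable : ∀ {F G H} → ProperlyColourable H G →
                    (φ : FullColouring G F) → ∀ {v} → Misses (proj₁ φ) v → FullColouring H F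
misses⇒colourable {F} {G} {H} proper (f , f-full) {v} miss =
  compose {F} {induced G S} {H} (proper S (⊆⊤ , v , ∈⊤ , x∈p⇒x∉∁p (x∈⁅x⁆ v)))
    (proj₁ ∘ index ,
     factor {F} {G} {induced G S} f f-full (enumerate S) (λ _ _ → ⇔-refl)
            (proj₁ ∘ index) (proj₂ ∘ index))
  where
  S : Subset (order G)
  S = ∁ ⁅ v ⁆

  index : ∀ x → ∃[ i ] enumerate S i ≡ f x
  index x = enumerate-complete S (x∉p⇒x∈∁p (x≢y⇒x∉⁅y⁆ (miss x)))

adjMatrix : (G : Graph) → Vertex G → Vertex G → Bool
adjMatrix G x y = does (adj? G x y)

does-≡⇒⇔ : {P Q : Set} (p? : Dec P) (q? : Dec Q) → does p? ≡ does q? → P ⇔ Q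
does-≡⇒⇔ (yes p) (yes q) _ = mk⇔ (λ _ → q) (λ _ → p)
does-≡⇒⇔ (no ¬p) (no ¬q) _ = mk⇔ (λ p → contradiction p ¬p) (λ q → contradiction q ¬q)

module _ (F : Graph) {x y : Vertex F} (x≢y : x ≢ y)
         (twins : ∀ z → Adj F x z ⇔ Adj F y z) where

  fold : Vertex F → Vertex F
  fold z with z ≟ x
  ... | yes _ = y
  ... | no  _ = z

  fold-misses : Misses fold x
  fold-misses z eq with z ≟ x
  ... | yes _  = x≢y (sym eq)
  ... | no z≢x = z≢x eq

  fold-adj : ∀ a b → Adj F a b ⇔ Adj F (fold a) b
  fold-adj a b with a ≟ x
  ... | yes refl = twins b
  ... | no  _    = ⇔-refl

  Adj-comm : ∀ a b → Adj F a b ⇔ Adj F b a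
  Adj-comm a b = mk⇔ (Graph.sym F) (Graph.sym F)

  -- The endpoints are folded one at a time; symmetry brings the second one into first position.
  fold-full : IsFullHom F F fold
  fold-full a b =
    ⇔-trans (fold-adj a b) (⇔-trans (Adj-comm (fold a) b)
      (⇔-trans (fold-adj b (fold a)) (Adj-comm (fold b) (fold a))))

obs⇒twin-free : ∀ {F H} → F ∈ obs H → Separates (adjMatrix F) id
obs⇒twin-free {F} {H} (¬col , proper) {x} {y} eq = decidable-stable (x ≟ y) λ x≢y →
  let twins = λ z → does-≡⇒⇔ (adj? F x z) (adj? F y z) (eq z) in
  ¬col (misses⇒colourable {F} {F} {H} proper
         (fold F x≢y twins , fold-full F x≢y twins) (fold-misses F x≢y twins))

-- Fullness makes vertices with equal images have the same neighbours in the range of `e`, and these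
-- neighbours already determine a vertex.
separating⇒injective : ∀ {F G} {e : Fin m → Vertex F} → Injective _≡_ _≡_ e →
                       Separates (adjMatrix F) e →
                       (φ : FullColouring G (pullback F e)) → Injective _≡_ _≡_ (proj₁ φ)
separating⇒injective {F = F} {G} {e} e-inj sep (f , f-full) {i} {j} fi≡fj =
  e-inj (sep λ k → does-⇔ (⇔-trans (f-full i k)
    (subst (λ a → Adj G a (f k) ⇔ Adj F (e j) (e k)) (sym fi≡fj) (⇔-sym (f-full j k))))
    (adj? F (e i) (e k)) (adj? F (e j) (e k)))

obs⇒injective : ∀ {F G H} → F ∈ obs H → (φ : FullColouring G F) → Injective _≡_ _≡_ (proj₁ φ)
obs⇒injective {F} {G} {H} F∈obs = separating⇒injective {F = F} {G} {id} id (obs⇒twin-free {F} {H} F∈obs)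

obs-deletion : ∀ {F H} → F ∈ obs H → order F ≡ suc m →
               ∃[ e ] Σ[ φ ∈ FullColouring H (pullback {m} F e) ] Injective _≡_ _≡_ (proj₁ φ)
obs-deletion {F = F} {H} F∈obs F≡1+m =
  embed , φ , separating⇒injective {F = F} {H} embed-injective embed-separates φ
  where
  open Deletion (separating-deletion (adjMatrix F) (obs⇒twin-free {F} {H} F∈obs) F≡1+m)

  φ : FullColouring H (pullback F embed)
  φ = misses⇒colourable {pullback F embed} {F} {H} (proj₂ F∈obs)
        (embed , λ _ _ → ⇔-refl) embed-misses

obs-order : ∀ {F H} → F ∈ obs H → order F ≤ suc (order H)
obs-order {F} {H} F∈obs = bound (order F) refl
  where
  -- `order F` is generalised to `n` so that the empty graph, which has no vertex to delete, can be
  -- split off.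
  bound : ∀ n → order F ≡ n → n ≤ suc (order H)
  bound zero  _     = z≤n
  bound (suc m) F≡1+m with _ , _ , φ-inj ← obs-deletion {m} {F} {H} F∈obs F≡1+m =
    s≤s (injective⇒≤ φ-inj)

-- The graph left after the deletion has exactly `order H` vertices, so its injective colouring is
-- onto, and a section of it maps `H` back into `G`.
obs*⇒colouring : ∀ {G H} → G ∈ obs* H → FullColouring G H
obs*⇒colouring {G} {H} (G∈obs , G≡H+1)
  with e , (φ , φ-full) , φ-inj ← obs-deletion {F = G} {H} G∈obs (trans G≡H+1 (ℕ.+-comm (order H) 1))
  = compose {H} {pullback G e} {G} (e , λ _ _ → ⇔-refl)
      (proj₁ ∘ surj , section-full {pullback G e} {H} φ φ-full surj)
  where surj = injective⇒surjective φ-inj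

bijective⇒≅ : ∀ {F G} (φ : FullColouring G F) →
              Injective _≡_ _≡_ (proj₁ φ) → StrictlySurjective _≡_ (proj₁ φ) → G ≅ F
bijective⇒≅ {F} {G} (f , f-full) inj surj =
  mk↔ₛ′ (proj₁ ∘ surj) f (λ x → inj (proj₂ (surj (f x)))) (proj₂ ∘ surj) ,
  section-full {F} {G} f f-full surj

≅⇒colouring : ∀ {F G} → G ≅ F → FullColouring G F
≅⇒colouring {F} {G} (iso , to-full) =
  from , factor {F} {F} {G} id (λ _ _ → ⇔-refl) to to-full from strictlyInverseˡ
  where open Inverse iso

theorem3p5 : (H G : Graph) → G ∈ obs* H →
    obs G ≐ ((obs H ∖ (G ≅_)) ∪ obs* G)
theorem3p5 H G G∈obs*@((_ , G-proper) , _) = (λ {F} → ⊆ {F}) , λ {F} → ⊇ {F}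
  where
  H→G : FullColouring G H
  H→G = obs*⇒colouring {G} {H} G∈obs*

  ⊆ : ∀ {F} → F ∈ obs G → F ∈ (obs H ∖ (G ≅_)) ∪ obs* G
  ⊆ {F} F∈obsG@(F↛G , F-proper) with order F ℕ.≟ order G + 1
  ... | yes F≡G+1 = inj₂ (F∈obsG , F≡G+1)
  ... | no  F≢G+1 =
    inj₁ (((λ F→H → F↛G (compose {F} {H} {G} H→G F→H)) , proper) , F↛G ∘ ≅⇒colouring {F} {G})
    where
    F≤G : order F ≤ order G
    F≤G = ℕ.≤-pred (ℕ.≤∧≢⇒< (obs-order {F} {G} F∈obsG)
                             (λ eq → F≢G+1 (trans eq (ℕ.+-comm 1 (order G)))))

    proper : ProperlyColourable H F
    proper S S⊂⊤ =
      -- A proper subset of at most `order G` vertices is too small for `φ` to be onto.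
      misses⇒colourable {induced F S} {G} {H} G-proper φ (proj₂ (<⇒misses S<G (proj₁ φ)))
      where
      φ : FullColouring G (induced F S)
      φ = F-proper S S⊂⊤

      S<G : ∣ S ∣ < order G
      S<G = ℕ.<-≤-trans (subst (∣ S ∣ <_) (∣⊤∣≡n (order F)) (p⊂q⇒∣p∣<∣q∣ S⊂⊤)) F≤G

  ⊇ : ∀ {F} → F ∈ (obs H ∖ (G ≅_)) ∪ obs* G → F ∈ obs G
  ⊇ (inj₂ (F∈obsG , _)) = F∈obsG
  ⊇ {F} (inj₁ (F∈obsH@(F↛H , F-proper) , G≇F)) =
    F↛G , λ S S⊂⊤ → compose {induced F S} {H} {G} H→G (F-proper S S⊂⊤)
    where
    F↛G : ¬ FullColouring G F
    F↛G φ with surjective⊎misses (proj₁ φ)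
    -- As `F` is twin-free, a colouring onto `G` would be an isomorphism, which is excluded.
    ... | inj₁ surj       = G≇F (bijective⇒≅ {F} {G} φ (obs⇒injective {F} {G} {H} F∈obsH φ) surj)
    ... | inj₂ (_ , miss) = F↛H (misses⇒colourable {F} {G} {H} G-proper φ miss)
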